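{- Let $P$ be a team property. Then the following are equivalent: (i) there is an $\mathsf{MTL}$-formula which expresses $P$; (ii) there is a first-order formula which expresses $P$, and $P$ is bisimulation-invariant; (iii) $P$ is invariant under $k$-bisimulation for some $k\in\mathbb N$; (iv) $P$ is bisimulation-invariant and local.
   Context: Fix a finite nonempty set $X$ of propositional variables. A Kripke model is $M=(W,R,\pi)$ with $W$ a nonempty set (of worlds), $R\subseteq W\times W$, $\pi\colon X\to 2^W$. A team of $M$ is a set $T\subseteq W$. $\mathsf{MTL}$ (modal team logic) has syntax $\varphi ::= p\mid\neg p\mid{\sim}\varphi\mid(\varphi\wedge\varphi)\mid(\varphi\vee\varphi)\mid\Diamond\varphi\mid\Box\varphi$ with $p\in X$. Team semantics, for $T\subseteq W$ (possibly empty): - $M,T\models p$ iff $T\subseteq\pi(p)$; $M,T\models\neg p$ iff $T\cap\pi(p)=\emptyset$; - $M,T\models{\sim}\psi$ iff $M,T\not\models\psi$; - $M,T\models\psi\wedge\chi$ iff $M,T\models\psi$ and $M,T\models\chi$; - $M,T\models\psi\vee\chi$ iff $T=T_1\cup T_2$ for some $T_1,T_2$ with $M,T_1\models\psi$ and $M,T_2\models\chi$; - $M,T\models\Diamond\psi$ iff there is a team $T'$ of $M$ with $M,T'\models\psi$ such that each $w\in T$ has some $w'\in T'$ with $(w,w')\in R$ and each $w'\in T'$ has some $w\in T$ with $(w,w')\in R$; - $M,T\models\Box\psi$ iff $M,T'\models\psi$ where $T'=\{w'\in W : (w,w')\in R\text{ for some }w\in T\}$. A team property is a class of pairs $(M,T)$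 where $M$ is a Kripke model and $T\neq\emptyset$ is a team of $M$. An $\mathsf{MTL}$-formula $\varphi$ expresses the team property consisting of all $(M,T)$ ($T\ne\emptyset$) with $M,T\models\varphi$. First-order expressibility: let $\sigma_X$ be the first-order signature with a binary relation symbol $E$, a unary relation symbol $T$, and a unary relation symbol $W_x$ for each $x\in X$. A model $M=(W,R,\pi)$ with team $T$ determines the $\sigma_X$-structure $\mathcal M_{M,T}$ with universe $W$, $E$ interpreted as $R$, $T$ as the team $T$, $W_x$ as $\pi(x)$. A first-order formula (sentence) $\varphi$ over $\sigma_X$ expresses $P$ if for all models $M$ with (nonempty) team $T$: $(M,T)\in P$ iff $\mathcal M_{M,T}\models\varphi$. $k$-bisimilarity of pointed models, for $M_i=(W_i,R_i,\pi_i)$: $(M_1,w_1)\rightleftharpoons_0(M_2,w_2)$ iff $w_1$ and $w_2$ satisfy the same propositional variables; $(M_1,w_1)\rightleftharpoons_{k+1}(M_2,w_2)$ iff $(M_1,w_1)\rightleftharpoons_0(M_2,w_2)$, for each successor $w_1'$ of $w_1$ there is a successor $w_2'$ of $w_2$ with $(M_1,w_1')\rightleftharpoons_k(M_2,w_2')$, and for each successor $w_2'$ of $w_2$ there is a successor $w_1'$ of $w_1$ with $(M_1,w_1')\rightleftharpoons_k(M_2,w_2')$. For teams, $(M_1,T_1)\rightleftharpoons_k(M_2,T_2)$ iff for each $w_1\in T_1$ there is $w_2\in T_2$ with $(M_1,w_1)\rightleftharpoons_k(M_2,w_2)$, and for each $w_2\in T_2$ there is $w_1\in T_1$ with $(M_1,w_1)\rightleftharpoons_k(M_2,w_2)$.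 Full bisimilarity of teams: $(M_1,T_1)\rightleftharpoons(M_2,T_2)$ iff there is $Z\subseteq W_1\times W_2$ such that for all $(w_1,w_2)\in Z$: $w_1,w_2$ satisfy the same propositional variables, each successor $w_1'$ of $w_1$ has a successor $w_2'$ of $w_2$ with $(w_1',w_2')\in Z$, and each successor $w_2'$ of $w_2$ has a successor $w_1'$ of $w_1$ with $(w_1',w_2')\in Z$; and moreover each $w_1\in T_1$ has some $w_2\in T_2$ with $(w_1,w_2)\in Z$ and each $w_2\in T_2$ has some $w_1\in T_1$ with $(w_1,w_2)\in Z$. $P$ is invariant under $k$-bisimulation (resp. bisimulation-invariant) if $(M_1,T_1)\in P$ and $(M_1,T_1)\rightleftharpoons_k(M_2,T_2)$ (resp. $(M_1,T_1)\rightleftharpoons(M_2,T_2)$) imply $(M_2,T_2)\in P$. Locality: the distance from $w$ to $w'$ in $M$ is the length of a shortest (directed) $R$-path from $w$ to $w'$ (infinite if none). For $d\in\mathbb N$, $\mathrm N^d_M(w)$ is the set of worlds at distance at most $d$ from $w$, and $\mathrm N^d_M(T)=\bigcup_{w\in T}\mathrm N^d_M(w)$, identified with the restriction of $M$ to this set of worlds. $P$ is $d$-local if for all models $M$ and teams $T$ (nonempty): $(M,T)\in P$ iff $(\mathrm N^d_M(T),T)\in P$. $P$ is local if it is $d$-local for some $d\in\mathbb N$. -}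

module Defs where

open import Data.Fin.Base using (Fin)
open import Data.Irrelevant using (Irrelevant; [_])
open import Data.Nat.Base using (ℕ; zero; suc; _≤_; z≤n)
open import Data.Product.Base using (Σ; ∃-syntax; _×_; _,_)
open import Data.Refinement.Base as Refinement using (Refinement; value)
open import Data.Sum.Base using (_⊎_)
open import Data.Vec.Base using (Vec; []; _∷_; lookup)
open import Function.Base using (_on_; _∘_)
open import Function.Bundles using (_⇔_)
open import Level using (Level; Lift; 0ℓ; _⊔_) renaming (suc to lsuc)
open import Relation.Binary.Core using (REL; Rel)
open import Relation.Binary.PropositionalEquality.Core using (_≡_; refl)
open import Relation.Nullary.Negation.Core using (¬_)
open import Relation.Unary using (Pred; _∈_; _⊆_; _≐_; _∪_; _∩_; Empty; Satisfiable)

private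
  variable
    X : Set
    ℓ : Level

-- The world witnessing non-emptiness is irrelevant, so that a model does
-- not come with a distinguished world.

record Model (X : Set) : Set₁ where
  field
    W        : Set
    R        : Rel W 0ℓ
    π        : X → Pred W 0ℓ
    nonempty : Irrelevant W

open Model public using (W; R; π)

Team : Model X → Set₁
Team M = Pred (W M) 0ℓ

record TeamModel (X : Set) : Set₁ where
  field
    model    : Model X
    team     : Team model
    nonempty : Irrelevant (Satisfiable team)

open TeamModel public using (model; team)

TeamProperty : Set → (ℓ : Level) → Set (lsuc 0ℓ ⊔ lsuc ℓ)
TeamProperty X ℓ = Pred (TeamModel X) ℓ

-- Back-and-forth (Egli–Milner) lifting of a relation to subsets.

Lifted : {A B : Set} → REL A B 0ℓ → Pred A 0ℓ → Pred B 0ℓ → Set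
Lifted Z S T =
  (∀ a → a ∈ S → ∃[ b ] (b ∈ T × Z a b)) ×
  (∀ b → b ∈ T → ∃[ a ] (a ∈ S × Z a b))

data MTL (X : Set) : Set where
  var  : X → MTL X
  ¬var : X → MTL X
  ∼_   : MTL X → MTL X
  _∧_  : MTL X → MTL X → MTL X
  _∨_  : MTL X → MTL X → MTL X
  ◇_   : MTL X → MTL X
  □_   : MTL X → MTL X

successors : (M : Model X) → Team M → Team M
successors M T w′ = ∃[ w ] (w ∈ T × R M w w′)

infix 4 _∣_⊨_

_∣_⊨_ : (M : Model X) → Team M → MTL X → Set₁
M ∣ T ⊨ var p   = Lift (lsuc 0ℓ) (T ⊆ π M p)
M ∣ T ⊨ ¬var p  = Lift (lsuc 0ℓ) (Empty (T ∩ π M p))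
M ∣ T ⊨ ∼ φ     = ¬ (M ∣ T ⊨ φ)
M ∣ T ⊨ (φ ∧ ψ) = (M ∣ T ⊨ φ) × (M ∣ T ⊨ ψ)
M ∣ T ⊨ (φ ∨ ψ) = Σ (Team M) λ T₁ → Σ (Team M) λ T₂ →
                    (T ≐ T₁ ∪ T₂) × (M ∣ T₁ ⊨ φ) × (M ∣ T₂ ⊨ ψ)
M ∣ T ⊨ ◇ φ     = Σ (Team M) λ T′ → (M ∣ T′ ⊨ φ) × Lifted (R M) T T′
M ∣ T ⊨ □ φ     = M ∣ successors M T ⊨ φ

ExpressesMTL : MTL X → TeamProperty X ℓ → Set (lsuc 0ℓ ⊔ ℓ)
ExpressesMTL φ P = ∀ A → A ∈ P ⇔ (model A ∣ team A ⊨ φ)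

-- First-order logic with equality over the signature σ_X. The free
-- variables of a formula are de Bruijn indices below n.

data FO (X : Set) (n : ℕ) : Set where
  _≐ᶠ_ : Fin n → Fin n → FO X n
  Eᶠ   : Fin n → Fin n → FO X n
  Tᶠ   : Fin n → FO X n
  Wᶠ   : X → Fin n → FO X n
  ¬ᶠ_  : FO X n → FO X n
  _∧ᶠ_ : FO X n → FO X n → FO X n
  _∨ᶠ_ : FO X n → FO X n → FO X n
  ∃ᶠ_  : FO X (suc n) → FO X n
  ∀ᶠ_  : FO X (suc n) → FO X n

Sentence : Set → Set
Sentence X = FO X 0

record Structure (X : Set) : Set₁ where
  field
    Universe : Set
    ⟦E⟧      : Rel Universe 0ℓ
    ⟦T⟧      : Pred Universe 0ℓ
    ⟦W⟧      : X → Pred Universe 0ℓ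

module _ (𝓜 : Structure X) where
  open Structure 𝓜

  Sat : ∀ {n} → FO X n → Vec Universe n → Set
  Sat (x ≐ᶠ y) ρ = lookup ρ x ≡ lookup ρ y
  Sat (Eᶠ x y) ρ = ⟦E⟧ (lookup ρ x) (lookup ρ y)
  Sat (Tᶠ x)   ρ = ⟦T⟧ (lookup ρ x)
  Sat (Wᶠ p x) ρ = ⟦W⟧ p (lookup ρ x)
  Sat (¬ᶠ φ)   ρ = ¬ Sat φ ρ
  Sat (φ ∧ᶠ ψ) ρ = Sat φ ρ × Sat ψ ρ
  Sat (φ ∨ᶠ ψ) ρ = Sat φ ρ ⊎ Sat ψ ρ
  Sat (∃ᶠ φ)   ρ = ∃[ a ] Sat φ (a ∷ ρ)
  Sat (∀ᶠ φ)   ρ = ∀ a → Sat φ (a ∷ ρ)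

infix 4 _⊨ᶠ_

_⊨ᶠ_ : Structure X → Sentence X → Set
𝓜 ⊨ᶠ φ = Sat 𝓜 φ []

structure : TeamModel X → Structure X
structure A = record
  { Universe = W (model A)
  ; ⟦E⟧      = R (model A)
  ; ⟦T⟧      = team A
  ; ⟦W⟧      = π (model A)
  }

ExpressesFO : Sentence X → TeamProperty X ℓ → Set (lsuc 0ℓ ⊔ ℓ)
ExpressesFO φ P = ∀ A → A ∈ P ⇔ (structure A ⊨ᶠ φ)

SameVars : (M₁ M₂ : Model X) → REL (W M₁) (W M₂) 0ℓ
SameVars M₁ M₂ w₁ w₂ = ∀ p → (w₁ ∈ π M₁ p) ⇔ (w₂ ∈ π M₂ p)

Bisim : ℕ → (M₁ M₂ : Model X) → REL (W M₁) (W M₂) 0ℓ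
Bisim zero    M₁ M₂ w₁ w₂ = SameVars M₁ M₂ w₁ w₂
Bisim (suc k) M₁ M₂ w₁ w₂ =
  SameVars M₁ M₂ w₁ w₂ × Lifted (Bisim k M₁ M₂) (R M₁ w₁) (R M₂ w₂)

TeamBisim : ℕ → Rel (TeamModel X) 0ℓ
TeamBisim k A B = Lifted (Bisim k (model A) (model B)) (team A) (team B)

IsBisimulation : (M₁ M₂ : Model X) → REL (W M₁) (W M₂) 0ℓ → Set
IsBisimulation M₁ M₂ Z = ∀ w₁ w₂ → Z w₁ w₂ →
  SameVars M₁ M₂ w₁ w₂ × Lifted Z (R M₁ w₁) (R M₂ w₂)

FullTeamBisim : Rel (TeamModel X) (lsuc 0ℓ)
FullTeamBisim A B = Σ (REL (W (model A)) (W (model B)) 0ℓ) λ Z →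
  IsBisimulation (model A) (model B) Z × Lifted Z (team A) (team B)

Invariant : ∀ {r} → Rel (TeamModel X) r → TeamProperty X ℓ → Set (lsuc 0ℓ ⊔ r ⊔ ℓ)
Invariant _≈_ P = ∀ A B → A ∈ P → A ≈ B → B ∈ P

BisimInvariant : TeamProperty X ℓ → Set (lsuc 0ℓ ⊔ ℓ)
BisimInvariant = Invariant FullTeamBisim

KBisimInvariant : ℕ → TeamProperty X ℓ → Set (lsuc 0ℓ ⊔ ℓ)
KBisimInvariant k = Invariant (TeamBisim k)

Path : (M : Model X) → ℕ → Rel (W M) 0ℓ
Path M zero    w w′ = w ≡ w′
Path M (suc n) w w′ = ∃[ v ] (R M w v × Path M n v w′)

-- No n satisfies this when w′ is unreachable from w (infinite distance).

IsDistance : (M : Model X) → W M → W M → ℕ → Set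
IsDistance M w w′ n = Path M n w w′ × (∀ m → Path M m w w′ → n ≤ m)

N : (M : Model X) → ℕ → W M → Pred (W M) 0ℓ
N M d w w′ = ∃[ n ] (IsDistance M w w′ n × n ≤ d)

Nᵀ : (M : Model X) → ℕ → Team M → Pred (W M) 0ℓ
Nᵀ M d T w′ = ∃[ w ] (w ∈ T × w′ ∈ N M d w)

-- Membership proofs are irrelevant in a Refinement, so the worlds of the
-- restriction are elements of the subset, without multiplicity.

restrict : (M : Model X) (S : Pred (W M) 0ℓ) → Irrelevant (Satisfiable S) → Model X
restrict M S [ s ] = record
  { W        = Refinement (W M) S
  ; R        = R M on value
  ; π        = λ p → π M p ∘ value
  ; nonempty = [ (let (w , w∈S) = s in w Refinement., [ w∈S ]) ]
  }

T⊆Nᵀ : (M : Model X) (d : ℕ) (T : Team M) → T ⊆ Nᵀ M d T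
T⊆Nᵀ M d T {w} w∈T = w , w∈T , 0 , (refl , λ _ _ → z≤n) , z≤n

neighbourhood : ℕ → TeamModel X → TeamModel X
neighbourhood d record { model = M ; team = T ; nonempty = [ t ] } = record
  { model    = restrict M (Nᵀ M d T) [ (let (w , w∈T) = t in w , T⊆Nᵀ M d T w∈T) ]
  ; team     = T ∘ value
  ; nonempty = [ (let (w , w∈T) = t in (w Refinement., [ T⊆Nᵀ M d T w∈T ]) , w∈T) ]
  }

Local : ℕ → TeamProperty X ℓ → Set (lsuc 0ℓ ⊔ ℓ)
Local d P = ∀ A → A ∈ P ⇔ neighbourhood d A ∈ P

{-# OPTIONS --safe #-}
module Submission where

-- Finitely many modal formulas determine the k-bisimulation type of a world, so a
-- k-invariant property of teams is a Boolean combination of statements "some world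
-- of the team satisfies χ", which both MTL and first-order logic express.
--
-- For the passage from (ii) or (iv) to (iii), replace A by a bisimilar model in
-- which every world carries a level that grows by one along each edge. If P does
-- not see the effect of cutting this model off at level d, then P is
-- d-bisimulation-invariant, as d-bisimilar teams have fully bisimilar cut-offs.
-- A d-local P does not see it, and neither does a first-order P for large d: put
-- next to each of the two models a teamless copy of the other, unreachable from
-- the team. Duplicator wins the Ehrenfeucht-Fraïssé game between the two sums by
-- the bijection that swaps the components from some level c on. It respects all
-- pebbles as long as none is near level c, and c can be moved away from each new
-- pebble.

open import Defs
open import Axiom.ExcludedMiddle using (ExcludedMiddle)
open import Data.Bool.Base using (Bool; true; false; not; _xor_)
open import Data.Bool.Properties using (not-injective; xor-assoc; xor-same)
open import Data.Empty using (⊥-elim)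
open import Data.Fin.Base using (Fin; zero; suc)
open import Data.Irrelevant as Irrelevant using ([_])
open import Data.List.Base using (List; []; _∷_; _++_; map; allFin)
open import Data.List.Membership.Propositional using () renaming (_∈_ to _∈ˡ_)
open import Data.List.Membership.Propositional.Properties
  using (∈-allFin; ∈-map⁺; ∈-++⁺ˡ; ∈-++⁺ʳ)
open import Data.List.Relation.Unary.Any using (here; there)
open import Data.Nat.Base using (ℕ; zero; suc; _+_; _∸_; _⊔_; _≤_; _<_; z≤n; s≤s)
open import Data.Nat.Properties
open import Data.Product.Base as Product using (∃; ∃-syntax; _×_; _,_; proj₁; proj₂)
open import Data.Product.Function.NonDependent.Propositional using (_×-⇔_)
open import Data.Refinement.Base using (value) renaming (_,_ to _,ʳ_)
open import Data.Sum.Base as Sum using (_⊎_; inj₁; inj₂)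
open import Data.Sum.Function.Propositional using (_⊎-⇔_)
open import Data.Vec.Base as Vec using (Vec; []; _∷_; lookup)
open import Data.Vec.Properties using (lookup-map)
open import Function.Base using (_∘_; flip)
open import Function.Bundles using (_↔_; _⇔_; mk⇔; Equivalence; Inverse)
open import Function.Construct.Composition using (_⇔-∘_)
open import Function.Construct.Identity using (⇔-id)
open import Function.Construct.Symmetry using (⇔-sym)
open import Function.Related.TypeIsomorphisms using (¬-cong-⇔)
open import Level using (Level; 0ℓ; lift) renaming (suc to lsuc)
open import Relation.Binary.Core using (REL)
open import Relation.Binary.PropositionalEquality
  using (_≡_; refl; sym; trans; cong; cong₂; subst)
open import Relation.Nullary.Decidable
  using (yes; no; does; recompute; decidable-stable; dec-true; dec-false)
open import Relation.Nullary.Negation.Core using (¬_; contradiction)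
open import Relation.Unary using (Pred; _∈_; _⊆_; _≐_; _∪_; _∩_; ∁)

open Equivalence using (to; from)

private
  variable
    X : Set
    ℓ ℓ′ : Level

-- Liftings and bisimilarity

Lifted-sym : {A B : Set} {Z : REL A B 0ℓ} {S : Pred A 0ℓ} {T : Pred B 0ℓ} →
             Lifted Z S T → Lifted (flip Z) T S
Lifted-sym (forth , back) = back , forth

Lifted-map : {A B : Set} {Z Z′ : REL A B 0ℓ} {S : Pred A 0ℓ} {T : Pred B 0ℓ} →
             (∀ {a b} → Z a b → Z′ a b) → Lifted Z S T → Lifted Z′ S T
Lifted-map f (forth , back) =
  (λ a a∈S → Product.map₂ (Product.map₂ f) (forth a a∈S)) ,
  (λ b b∈T → Product.map₂ (Product.map₂ f) (back b b∈T))

Image : {A B : Set} → REL A B 0ℓ → Pred A 0ℓ → Pred B 0ℓ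
Image Z S b = ∃[ a ] (a ∈ S × Z a b)

-- The subteams chosen in `∨` and `◇` are carried to the other model by taking the partners of their
-- worlds; `Image` supplies the back condition.
Lifted-image : {A B : Set} {Z : REL A B 0ℓ} {S S₁ : Pred A 0ℓ} {T : Pred B 0ℓ} →
               Lifted Z S T → S₁ ⊆ S → Lifted Z S₁ (T ∩ Image Z S₁)
Lifted-image (forth , _) S₁⊆S =
  (λ a a∈S₁ → let (b , b∈T , z) = forth a (S₁⊆S a∈S₁) in b , (b∈T , a , a∈S₁ , z) , z) ,
  (λ b (_ , im) → im)

SameVars-sym : (M N : Model X) {w : W M} {v : W N} → SameVars M N w v → SameVars N M v w
SameVars-sym M N same p = ⇔-sym (same p)

Bisim-sym : (M N : Model X) (k : ℕ) {w : W M} {v : W N} → Bisim k M N w v → Bisim k N M v w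
Bisim-sym M N zero    same       = SameVars-sym M N same
Bisim-sym M N (suc k) (same , l) =
  SameVars-sym M N same , Lifted-map (Bisim-sym M N k) (Lifted-sym l)

Bisim⇒SameVars : (M N : Model X) (k : ℕ) {w : W M} {v : W N} →
                 Bisim k M N w v → SameVars M N w v
Bisim⇒SameVars M N zero    same       = same
Bisim⇒SameVars M N (suc k) (same , _) = same

TeamBisim-sym : (k : ℕ) (A B : TeamModel X) → TeamBisim k A B → TeamBisim k B A
TeamBisim-sym k A B l = Lifted-map (Bisim-sym (model A) (model B) k) (Lifted-sym l)

FullTeamBisim-sym : (A B : TeamModel X) → FullTeamBisim A B → FullTeamBisim B A
FullTeamBisim-sym A B (Z , bis , l) =
  flip Z ,
  (λ v w z → let (same , l′) = bis w v z in
    SameVars-sym (model A) (model B) same , Lifted-sym l′) ,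
  Lifted-sym l

bisimulation⇒Bisim : (M N : Model X) {Z : REL (W M) (W N) 0ℓ} → IsBisimulation M N Z →
                     ∀ k {w v} → Z w v → Bisim k M N w v
bisimulation⇒Bisim M N bis zero    z = proj₁ (bis _ _ z)
bisimulation⇒Bisim M N bis (suc k) z =
  let (same , l) = bis _ _ z in same , Lifted-map (bisimulation⇒Bisim M N bis k) l

kInvariant⇒bisimInvariant : {P : TeamProperty X ℓ} (k : ℕ) →
                            KBisimInvariant k P → BisimInvariant P
kInvariant⇒bisimInvariant k inv A B A∈P (_ , bis , l) =
  inv A B A∈P (Lifted-map (bisimulation⇒Bisim (model A) (model B) bis k) l)

bisimInvariant-⇔ : {P : TeamProperty X ℓ} → BisimInvariant P →
                   ∀ A B → FullTeamBisim A B → A ∈ P ⇔ B ∈ P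
bisimInvariant-⇔ inv A B A~B =
  mk⇔ (λ A∈P → inv A B A∈P A~B) (λ B∈P → inv B A B∈P (FullTeamBisim-sym A B A~B))

-- Invariance of MTL under k-bisimulation

depth : MTL X → ℕ
depth (var p)  = 0
depth (¬var p) = 0
depth (∼ φ)    = depth φ
depth (φ ∧ ψ)  = depth φ ⊔ depth ψ
depth (φ ∨ ψ)  = depth φ ⊔ depth ψ
depth (◇ φ)    = suc (depth φ)
depth (□ φ)    = suc (depth φ)

Lifted-successors : (M N : Model X) (k : ℕ) {S : Team M} {T : Team N} →
                    Lifted (Bisim (suc k) M N) S T →
                    Lifted (Bisim k M N) (successors M S) (successors N T)
Lifted-successors M N k (forth , back) =
  (λ s′ (s , s∈S , Rss′) →
    let (t , t∈T , _ , forth′ , _) = forth s s∈S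
        (t′ , Rtt′ , z)            = forth′ s′ Rss′
    in t′ , (t , t∈T , Rtt′) , z) ,
  (λ t′ (t , t∈T , Rtt′) →
    let (s , s∈S , _ , _ , back′) = back t t∈T
        (s′ , Rss′ , z)           = back′ t′ Rtt′
    in s′ , (s , s∈S , Rss′) , z)

-- The bound `depth φ ≤ k`, rather than equality, lets both operands of `∧` and `∨` use the same
-- `k`. Negation exchanges the two models.
MTL-invariant : (M N : Model X) (φ : MTL X) {k : ℕ} → depth φ ≤ k →
                {S : Team M} {T : Team N} → Lifted (Bisim k M N) S T →
                M ∣ S ⊨ φ → N ∣ T ⊨ φ
MTL-invariant M N (var p) {k} _ (_ , back) (lift S⊆p) = lift λ t∈T →
  let (s , s∈S , z) = back _ t∈T in to (Bisim⇒SameVars M N k z p) (S⊆p s∈S)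
MTL-invariant M N (¬var p) {k} _ (_ , back) (lift S∩p) = lift λ t (t∈T , t∈p) →
  let (s , s∈S , z) = back _ t∈T in S∩p s (s∈S , from (Bisim⇒SameVars M N k z p) t∈p)
MTL-invariant M N (∼ φ) {k} d≤k l ¬sat sat =
  ¬sat (MTL-invariant N M φ d≤k (Lifted-map (Bisim-sym M N k) (Lifted-sym l)) sat)
MTL-invariant M N (φ ∧ ψ) d≤k l (satφ , satψ) =
  MTL-invariant M N φ (m⊔n≤o⇒m≤o _ _ d≤k) l satφ ,
  MTL-invariant M N ψ (m⊔n≤o⇒n≤o (depth φ) _ d≤k) l satψ
MTL-invariant M N (φ ∨ ψ) {k} d≤k {S} {T} l (S₁ , S₂ , (S⊆ , ⊆S) , satφ , satψ) =
  T ∩ Image (Bisim k M N) S₁ , T ∩ Image (Bisim k M N) S₂ ,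
  ((λ t∈T → let (s , s∈S , z) = proj₂ l _ t∈T in
      Sum.map (λ s∈S₁ → t∈T , s , s∈S₁ , z) (λ s∈S₂ → t∈T , s , s∈S₂ , z) (S⊆ s∈S)) ,
   Sum.[ proj₁ , proj₁ ]) ,
  MTL-invariant M N φ (m⊔n≤o⇒m≤o _ _ d≤k) (Lifted-image l (⊆S ∘ inj₁)) satφ ,
  MTL-invariant M N ψ (m⊔n≤o⇒n≤o (depth φ) _ d≤k) (Lifted-image l (⊆S ∘ inj₂)) satψ
MTL-invariant M N (◇ φ) {suc k} (s≤s d≤k) {S} {T} l (S′ , sat , forthR , backR) =
  -- Each `t` reaches this team: go back to some `s`, step into `S′`, go forth again. `backR` places
  -- `S′` among the successors of `S`.
  successors N T ∩ Image (Bisim k M N) S′ ,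
  MTL-invariant M N φ d≤k (Lifted-image (Lifted-successors M N k l) (backR _)) sat ,
  (λ t t∈T →
    let (s , s∈S , _ , forth , _) = proj₂ l t t∈T
        (s′ , s′∈S′ , Rss′)       = forthR s s∈S
        (t′ , Rtt′ , z)           = forth s′ Rss′
    in t′ , ((t , t∈T , Rtt′) , s′ , s′∈S′ , z) , Rtt′) ,
  (λ t′ (t′∈ , _) → t′∈)
MTL-invariant M N (□ φ) {suc k} (s≤s d≤k) l sat =
  MTL-invariant M N φ d≤k (Lifted-successors M N k l) sat

expressesMTL⇒kInvariant : {P : TeamProperty X ℓ} (φ : MTL X) →
                          ExpressesMTL φ P → KBisimInvariant (depth φ) P
expressesMTL⇒kInvariant φ expr A B A∈P A~B =
  from (expr B) (MTL-invariant (model A) (model B) φ ≤-refl A~B (to (expr A) A∈P))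

-- Basic modal logic on pointed models

data ML (X : Set) : Set where
  varᵐ : X → ML X
  ¬ᵐ_  : ML X → ML X
  _∧ᵐ_ : ML X → ML X → ML X
  ◇ᵐ_  : ML X → ML X

⟦_⟧ : ML X → (M : Model X) → Pred (W M) 0ℓ
⟦ varᵐ p ⟧ M w = w ∈ π M p
⟦ ¬ᵐ χ   ⟧ M w = ¬ ⟦ χ ⟧ M w
⟦ χ ∧ᵐ ξ ⟧ M w = ⟦ χ ⟧ M w × ⟦ ξ ⟧ M w
⟦ ◇ᵐ χ   ⟧ M w = ∃[ v ] (R M w v × ⟦ χ ⟧ M v)

ST : ML X → ∀ {n} → Fin n → FO X n
ST (varᵐ p) x = Wᶠ p x
ST (¬ᵐ χ)   x = ¬ᶠ ST χ x
ST (χ ∧ᵐ ξ) x = ST χ x ∧ᶠ ST ξ x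
ST (◇ᵐ χ)   x = ∃ᶠ (Eᶠ (suc x) zero ∧ᶠ ST χ zero)

ST-correct : (A : TeamModel X) (χ : ML X) {n : ℕ} (x : Fin n) (ρ : Vec (W (model A)) n) →
             lookup ρ x ∈ ⟦ χ ⟧ (model A) ⇔ Sat (structure A) (ST χ x) ρ
ST-correct A (varᵐ p) x ρ = ⇔-id _
ST-correct A (¬ᵐ χ)   x ρ = ¬-cong-⇔ (ST-correct A χ x ρ)
ST-correct A (χ ∧ᵐ ξ) x ρ = ST-correct A χ x ρ ×-⇔ ST-correct A ξ x ρ
ST-correct A (◇ᵐ χ)   x ρ = mk⇔
  (λ (v , Rwv , sat) → v , Rwv , to (ST-correct A χ zero (v ∷ ρ)) sat)
  (λ (v , Rwv , sat) → v , Rwv , from (ST-correct A χ zero (v ∷ ρ)) sat)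

-- `∼` negates for the team as a whole, not at each world, so pointwise negation is pushed to the
-- variables: `none` turns conjunction into splitting and diamond into box.
every none : ML X → MTL X
every (varᵐ p) = var p
every (¬ᵐ χ)   = none χ
every (χ ∧ᵐ ξ) = every χ ∧ every ξ
every (◇ᵐ χ)   = ◇ every χ
none (varᵐ p) = ¬var p
none (¬ᵐ χ)   = every χ
none (χ ∧ᵐ ξ) = none χ ∨ none ξ
none (◇ᵐ χ)   = □ none χ

-- Properties definable in both logics

Occurs : ML X → TeamProperty X 0ℓ
Occurs χ A = ∃[ w ] (w ∈ team A × w ∈ ⟦ χ ⟧ (model A))

Definable : TeamProperty X ℓ → Set (lsuc 0ℓ Level.⊔ ℓ)
Definable P = ∃ (λ φ → ExpressesMTL φ P) × ∃ (λ φ → ExpressesFO φ P)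

definable-resp : {P : TeamProperty X ℓ} {Q : TeamProperty X ℓ′} →
                 (∀ A → A ∈ P ⇔ A ∈ Q) → Definable Q → Definable P
definable-resp P⇔Q ((φ , eφ) , (ψ , eψ)) =
  (φ , λ A → eφ A ⇔-∘ P⇔Q A) , (ψ , λ A → eψ A ⇔-∘ P⇔Q A)

definable-∁ : {P : TeamProperty X ℓ} → Definable P → Definable (∁ P)
definable-∁ ((φ , eφ) , (ψ , eψ)) =
  (∼ φ , ¬-cong-⇔ ∘ eφ) , (¬ᶠ ψ , ¬-cong-⇔ ∘ eψ)

definable-∩ : {P : TeamProperty X ℓ} {Q : TeamProperty X ℓ′} →
              Definable P → Definable Q → Definable (P ∩ Q)
definable-∩ ((φ , eφ) , (ψ , eψ)) ((φ′ , eφ′) , (ψ′ , eψ′)) =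
  (φ ∧ φ′ , λ A → eφ A ×-⇔ eφ′ A) , (ψ ∧ᶠ ψ′ , λ A → eψ A ×-⇔ eψ′ A)

-- Formulas that determine k-bisimilarity

AgreeAt : List (ML X) → (M N : Model X) → REL (W M) (W N) 0ℓ
AgreeAt χs M N w v = ∀ {χ} → χ ∈ˡ χs → w ∈ ⟦ χ ⟧ M ⇔ v ∈ ⟦ χ ⟧ N

AgreeOn : List (ML X) → REL (TeamModel X) (TeamModel X) 0ℓ
AgreeOn χs A B = ∀ {χ} → χ ∈ˡ χs → A ∈ Occurs χ ⇔ B ∈ Occurs χ

-- `ML` has no constants, so a tautology is built from a variable.
⊤ᵐ : X → ML X
⊤ᵐ p = ¬ᵐ (varᵐ p ∧ᵐ (¬ᵐ varᵐ p))

descriptions : X → List (ML X) → List (ML X)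
descriptions p []       = ⊤ᵐ p ∷ []
descriptions p (χ ∷ χs) =
  map (χ ∧ᵐ_) (descriptions p χs) ++ map ((¬ᵐ χ) ∧ᵐ_) (descriptions p χs)

-- The truth values of this list at a world fix its k-bisimulation type: stage `suc k` asks which
-- types of stage `k` occur among the successors.
characteristic : X → List X → ℕ → List (ML X)
characteristic p ps zero    = map varᵐ ps
characteristic p ps (suc k) =
  map varᵐ ps ++ map ◇ᵐ_ (descriptions p (characteristic p ps k))

module Classical (em : ∀ {a} → ExcludedMiddle a) where

  stable : {A : Set ℓ} → ¬ ¬ A → A
  stable = decidable-stable em

  ≐-split : {A : Set} (S Q : Pred A 0ℓ) → S ≐ (S ∩ ∁ Q) ∪ (S ∩ Q)
  ≐-split {A} S Q = S⊆ , Sum.[ proj₁ , proj₁ ]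
    where
    S⊆ : S ⊆ (S ∩ ∁ Q) ∪ (S ∩ Q)
    S⊆ {a} a∈S with em {P = a ∈ Q}
    ... | yes a∈Q = inj₂ (a∈S , a∈Q)
    ... | no  a∉Q = inj₁ (a∈S , a∉Q)

  every-correct : (M : Model X) (T : Team M) (χ : ML X) →
                  (M ∣ T ⊨ every χ) ⇔ (∀ w → w ∈ T → w ∈ ⟦ χ ⟧ M)
  none-correct : (M : Model X) (T : Team M) (χ : ML X) →
                 (M ∣ T ⊨ none χ) ⇔ (∀ w → w ∈ T → ¬ w ∈ ⟦ χ ⟧ M)
  every-correct M T (varᵐ p) = mk⇔ (λ (lift T⊆p) w w∈T → T⊆p w∈T) (λ f → lift λ {w} → f w)
  every-correct M T (¬ᵐ χ)   = none-correct M T χ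
  every-correct M T (χ ∧ᵐ ξ) = mk⇔
    (λ (satχ , satξ) w w∈T →
      to (every-correct M T χ) satχ w w∈T , to (every-correct M T ξ) satξ w w∈T)
    (λ f → from (every-correct M T χ) (λ w w∈T → proj₁ (f w w∈T)) ,
           from (every-correct M T ξ) (λ w w∈T → proj₂ (f w w∈T)))
  every-correct M T (◇ᵐ χ) = mk⇔
    (λ (T′ , sat , forth , _) w w∈T → let (v , v∈T′ , Rwv) = forth w w∈T in
      v , Rwv , to (every-correct M T′ χ) sat v v∈T′)
    -- The largest possible choice: all successors of `T` that satisfy `χ`.
    (λ (f : ∀ w → w ∈ T → w ∈ ⟦ ◇ᵐ χ ⟧ M) → let T′ = successors M T ∩ ⟦ χ ⟧ M in
      T′ , from (every-correct M T′ χ) (λ _ → proj₂) ,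
      (λ w w∈T → let (v , Rwv , sat) = f w w∈T in v , ((w , w∈T , Rwv) , sat) , Rwv) ,
      (λ _ → proj₁))
  none-correct M T (varᵐ p) = mk⇔
    (λ (lift disj) w w∈T w∈p → disj w (w∈T , w∈p))
    (λ f → lift λ w (w∈T , w∈p) → f w w∈T w∈p)
  none-correct M T (¬ᵐ χ) = mk⇔
    (λ sat w w∈T ¬χ → ¬χ (to (every-correct M T χ) sat w w∈T))
    (λ f → from (every-correct M T χ) (λ w w∈T → stable (f w w∈T)))
  none-correct M T (χ ∧ᵐ ξ) = mk⇔
    (λ (T₁ , T₂ , (T⊆ , _) , satχ , satξ) w w∈T (wχ , wξ) →
      Sum.[ (λ w∈T₁ → to (none-correct M T₁ χ) satχ w w∈T₁ wχ) ,
            (λ w∈T₂ → to (none-correct M T₂ ξ) satξ w w∈T₂ wξ) ] (T⊆ w∈T))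
    -- Worlds satisfying `χ` go to the right part, where they must fail `ξ`.
    (λ f → T ∩ ∁ (⟦ χ ⟧ M) , T ∩ ⟦ χ ⟧ M , ≐-split T (⟦ χ ⟧ M) ,
      from (none-correct M _ χ) (λ _ → proj₂) ,
      from (none-correct M _ ξ) (λ w (w∈T , wχ) wξ → f w w∈T (wχ , wξ)))
  none-correct M T (◇ᵐ χ) = mk⇔
    (λ sat w w∈T (v , Rwv , vχ) →
      to (none-correct M (successors M T) χ) sat v (w , w∈T , Rwv) vχ)
    (λ f → from (none-correct M (successors M T) χ)
      (λ v (w , w∈T , Rwv) vχ → f w w∈T (v , Rwv , vχ)))

  definable-Occurs : (χ : ML X) → Definable (Occurs χ)
  definable-Occurs χ =
    (∼ none χ , λ A → let correct = none-correct (model A) (team A) χ in mk⇔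
      (λ (w , w∈T , wχ) sat → to correct sat w w∈T wχ)
      (λ ¬sat → stable λ ¬occurs →
        ¬sat (from correct λ w w∈T wχ → ¬occurs (w , w∈T , wχ)))) ,
    (∃ᶠ (Tᶠ zero ∧ᶠ ST χ zero) , λ A → mk⇔
      (λ (w , w∈T , wχ) → w , w∈T , to (ST-correct A χ zero (w ∷ [])) wχ)
      (λ (w , w∈T , wχ) → w , w∈T , from (ST-correct A χ zero (w ∷ [])) wχ))

  definable-∪ : {P : TeamProperty X ℓ} {Q : TeamProperty X ℓ′} →
                Definable P → Definable Q → Definable (P ∪ Q)
  definable-∪ dP dQ = definable-resp
    (λ A → mk⇔
      (λ P∪Q (¬P , ¬Q) → Sum.[ ¬P , ¬Q ] P∪Q)
      (λ ¬¬P∪Q → stable λ ¬P∪Q → ¬¬P∪Q (¬P∪Q ∘ inj₁ , ¬P∪Q ∘ inj₂)))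
    (definable-∁ (definable-∩ (definable-∁ dP) (definable-∁ dQ)))

  -- Induction on the list, splitting by whether `χ` occurs in the team. The variable `p` only
  -- serves to write down the constant properties.
  determined⇒definable : (p : X) (χs : List (ML X)) (P : TeamProperty X ℓ) →
                         Invariant (AgreeOn χs) P → Definable P
  determined⇒definable p [] P inv with em {P = ∃ P}
  -- All team models agree on the empty list, so one member of `P` makes `P` hold everywhere.
  ... | yes (B , B∈P) = definable-resp
        (λ A → mk⇔ (λ _ (occ , ¬occ) → ¬occ occ) (λ _ → inv B A B∈P λ ()))
        (definable-∁ (definable-∩ dp (definable-∁ dp)))
    where dp = definable-Occurs (varᵐ p)
  ... | no ∄P = definable-resp
        (λ A → mk⇔ (λ A∈P → contradiction (A , A∈P) ∄P)
                   (λ (occ , ¬occ) → contradiction occ ¬occ))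
        (definable-∩ dp (definable-∁ dp))
    where dp = definable-Occurs (varᵐ p)
  determined⇒definable {X = X} {ℓ = ℓ} p (χ ∷ χs) P inv =
    definable-resp split
      (definable-∪
        (definable-∩ dχ (determined⇒definable p χs (P∣ Occurs χ) P∣-inv))
        (definable-∩ (definable-∁ dχ) (determined⇒definable p χs (P∣ ∁ (Occurs χ)) P∣-inv)))
    where
    dχ = definable-Occurs χ

    -- The closure of `P ∩ Q` under agreement on `χs`, hence invariant; for both `Q` used it
    -- coincides with `P` on `Q`. Quantifying over team models raises the universe level, so the
    -- induction ranges over all levels.
    P∣_ : TeamProperty X 0ℓ → TeamProperty X (lsuc 0ℓ Level.⊔ ℓ)
    (P∣ Q) A = ∃[ B ] (AgreeOn χs B A × B ∈ Q × B ∈ P)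

    P∣-inv : ∀ {Q} → Invariant (AgreeOn χs) (P∣ Q)
    P∣-inv A A′ (B , agree , rest) agree′ =
      B , (λ ξ∈ → agree′ ξ∈ ⇔-∘ agree ξ∈) , rest

    cons : ∀ A B → (A ∈ Occurs χ ⇔ B ∈ Occurs χ) → AgreeOn χs A B → AgreeOn (χ ∷ χs) A B
    cons _ _ same agree (here refl) = same
    cons _ _ same agree (there ξ∈)  = agree ξ∈

    split : ∀ A → A ∈ P ⇔
      A ∈ ((Occurs χ ∩ (P∣ Occurs χ)) ∪ (∁ (Occurs χ) ∩ (P∣ ∁ (Occurs χ))))
    split A = mk⇔ split⁺ split⁻
      where
      split⁺ : _ → _
      split⁺ A∈P with em {P = A ∈ Occurs χ}
      ... | yes occ = inj₁ (occ , A , (λ {_} _ → ⇔-id _) , occ , A∈P)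
      ... | no ¬occ = inj₂ (¬occ , A , (λ {_} _ → ⇔-id _) , ¬occ , A∈P)
      split⁻ : _ → _
      split⁻ (inj₁ (occ , B , agree , occB , B∈P)) =
        inv B A B∈P (cons B A (mk⇔ (λ _ → occ) (λ _ → occB)) agree)
      split⁻ (inj₂ (¬occ , B , agree , ¬occB , B∈P)) =
        inv B A B∈P (cons B A (mk⇔ (⊥-elim ∘ ¬occB) (⊥-elim ∘ ¬occ)) agree)

  -- Deciding the formulas at `w` one by one picks the signs; a world with the same signs agrees
  -- with `w`.
  described : (p : X) (χs : List (ML X)) (M : Model X) (w : W M) →
    ∃[ δ ] (δ ∈ˡ descriptions p χs × w ∈ ⟦ δ ⟧ M ×
            (∀ N v → v ∈ ⟦ δ ⟧ N → AgreeAt χs M N w v))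
  described p [] M w =
    ⊤ᵐ p , here refl , (λ (wp , ¬wp) → ¬wp wp) , λ _ _ _ ()
  described p (χ ∷ χs) M w
    with (δ , δ∈ , wδ , agree) ← described p χs M w | em {P = w ∈ ⟦ χ ⟧ M}
  ... | yes wχ = χ ∧ᵐ δ , ∈-++⁺ˡ (∈-map⁺ _ δ∈) , (wχ , wδ) , λ where
          N v (vχ , _) (here refl) → mk⇔ (λ _ → vχ) (λ _ → wχ)
          N v (_ , vδ) (there ξ∈)  → agree N v vδ ξ∈
  ... | no ¬wχ = (¬ᵐ χ) ∧ᵐ δ , ∈-++⁺ʳ _ (∈-map⁺ _ δ∈) , (¬wχ , wδ) , λ where
          N v (¬vχ , _) (here refl) → mk⇔ (⊥-elim ∘ ¬wχ) (⊥-elim ∘ ¬vχ)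
          N v (_ , vδ)  (there ξ∈)  → agree N v vδ ξ∈

  module _ (p : X) (ps : List X) (complete : ∀ q → q ∈ˡ ps) where

    -- A description `δ` of a successor puts `◇ᵐ δ` into the list, so the other world has a
    -- successor satisfying `δ` too, and the two agree at stage `k`.
    agreeAt⇒Bisim : (M N : Model X) (k : ℕ) {w : W M} {v : W N} →
                    AgreeAt (characteristic p ps k) M N w v → Bisim k M N w v
    agreeAt⇒Bisim M N zero    agree q = agree (∈-map⁺ varᵐ (complete q))
    agreeAt⇒Bisim M N (suc k) {w} {v} agree =
      (λ q → agree (∈-++⁺ˡ (∈-map⁺ varᵐ (complete q)))) ,
      (λ w′ Rww′ →
        let (δ , δ∈ , w′δ , char) = described p (characteristic p ps k) M w′
            (v′ , Rvv′ , v′δ)     = to (agree (∈-++⁺ʳ _ (∈-map⁺ ◇ᵐ_ δ∈))) (w′ , Rww′ , w′δ)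
        in v′ , Rvv′ , agreeAt⇒Bisim M N k (char N v′ v′δ)) ,
      (λ v′ Rvv′ →
        let (δ , δ∈ , v′δ , char) = described p (characteristic p ps k) N v′
            (w′ , Rww′ , w′δ)     = from (agree (∈-++⁺ʳ _ (∈-map⁺ ◇ᵐ_ δ∈))) (v′ , Rvv′ , v′δ)
        in w′ , Rww′ , agreeAt⇒Bisim M N k (λ ξ∈ → ⇔-sym (char M w′ w′δ ξ∈)))

    agreeOn⇒TeamBisim : (k : ℕ) (A B : TeamModel X) →
                        AgreeOn (descriptions p (characteristic p ps k)) A B → TeamBisim k A B
    agreeOn⇒TeamBisim k A B agree =
      (λ w w∈T →
        let (δ , δ∈ , wδ , char) = described p (characteristic p ps k) (model A) w
            (v , v∈T , vδ)       = to (agree δ∈) (w , w∈T , wδ)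
        in v , v∈T , agreeAt⇒Bisim (model A) (model B) k (char (model B) v vδ)) ,
      (λ v v∈T →
        let (δ , δ∈ , vδ , char) = described p (characteristic p ps k) (model B) v
            (w , w∈T , wδ)       = from (agree δ∈) (v , v∈T , vδ)
        in w , w∈T ,
           agreeAt⇒Bisim (model A) (model B) k (λ ξ∈ → ⇔-sym (char (model A) w wδ ξ∈)))

    kInvariant⇒definable : {P : TeamProperty X ℓ} (k : ℕ) → KBisimInvariant k P → Definable P
    kInvariant⇒definable {P = P} k inv =
      determined⇒definable p (descriptions p (characteristic p ps k)) P
        (λ A B A∈P agree → inv A B A∈P (agreeOn⇒TeamBisim k A B agree))

-- Locality

path-snoc : (M : Model X) (n : ℕ) {w v u : W M} →
            Path M n w v → R M v u → Path M (suc n) w u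
path-snoc M zero    refl           Rvu = _ , Rvu , refl
path-snoc M (suc n) (x , Rwx , pth) Rvu = x , Rwx , path-snoc M n pth Rvu

Reached : (A : TeamModel X) → ℕ → Pred (W (model A)) 0ℓ
Reached A n u = ∃[ t ] (t ∈ team A × Path (model A) n t u)

reached-suc : (A : TeamModel X) {n : ℕ} {u v : W (model A)} →
              Reached A n u → R (model A) u v → Reached A (suc n) v
reached-suc A {n} (t , t∈T , pth) Ruv = t , t∈T , path-snoc (model A) n pth Ruv

-- Side true of the universe carries the team. Both sides keep the edges up to
-- level d; only side full keeps those beyond it. Layered true d A is thus an
-- unravelling of A beside a truncated copy without a team, and Layered false d A
-- is the same with the two roles exchanged.
Layered : Bool → ℕ → TeamModel X → TeamModel X
Layered full d A = record
  { model = record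
    { W        = W (model A) × ℕ × Bool
    ; R        = λ (w , n , b) (v , m , c) →
                   R (model A) w v × m ≡ suc n × c ≡ b × (b ≡ full ⊎ m ≤ d)
    ; π        = λ p (w , _) → w ∈ π (model A) p
    ; nonempty = Irrelevant.map (λ (w , _) → w , 0 , true) (TeamModel.nonempty A)
    }
  ; team     = λ (w , n , b) → w ∈ team A × n ≡ 0 × b ≡ true
  ; nonempty = Irrelevant.map (λ (w , w∈T) → (w , 0 , true) , w∈T , refl , refl)
                              (TeamModel.nonempty A)
  }

-- Side `true` is full here, so a world can be related to all its copies on that side without losing
-- an edge.
unlayer-bisim : (d : ℕ) (A : TeamModel X) → FullTeamBisim A (Layered true d A)
unlayer-bisim d A =
  (λ w (v , _ , b) → w ≡ v × b ≡ true) ,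
  (λ { w (_ , n , _) (refl , refl) →
       (λ _ → ⇔-id _) ,
       (λ v Rwv → (v , suc n , true) , (Rwv , refl , refl , inj₁ refl) , refl , refl) ,
       (λ { (v , _) (Rwv , _ , c≡b , _) → v , Rwv , refl , c≡b }) }) ,
  (λ w w∈T → (w , 0 , true) , (w∈T , refl , refl) , refl , refl) ,
  (λ { (w , _) (w∈T , _ , b≡true) → w , w∈T , refl , b≡true })

-- From level `n` the team side allows only `d - n` more steps. Bisimilarity of the underlying
-- worlds for that many rounds, counted by `j`, runs out exactly where the edges stop.
truncated-bisim : (d : ℕ) (A B : TeamModel X) → TeamBisim d A B →
                  FullTeamBisim (Layered false d A) (Layered false d B)
truncated-bisim d A B (forth , back) = Z , bis ,
  (λ { (w , _) (w∈T , refl , refl) →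
       let (v , v∈T , z) = forth w w∈T
       in (v , 0 , true) , (v∈T , refl , refl) , refl , refl , refl , d , refl , z }) ,
  (λ { (v , _) (v∈T , refl , refl) →
       let (w , w∈T , z) = back v v∈T
       in (w , 0 , true) , (w∈T , refl , refl) , refl , refl , refl , d , refl , z })
  where
  Z : REL (W (model (Layered false d A))) (W (model (Layered false d B))) 0ℓ
  Z (w , n , b) (v , m , c) =
    b ≡ true × c ≡ true × m ≡ n × ∃[ j ] (n + j ≡ d × Bisim j (model A) (model B) w v)

  top : ∀ {n b} → b ≡ true → n + 0 ≡ d → ¬ (b ≡ false ⊎ suc n ≤ d)
  top refl n≡d (inj₂ n<d) = <⇒≢ n<d (trans (sym (+-identityʳ _)) n≡d)

  bis : IsBisimulation (model (Layered false d A)) (model (Layered false d B)) Z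
  bis (w , n , b) (v , m , c) (b≡ , c≡ , refl , zero , n≡d , z) =
    z ,
    (λ { _ (_ , refl , _ , e) → ⊥-elim (top b≡ n≡d e) }) ,
    (λ { _ (_ , refl , _ , e) → ⊥-elim (top c≡ n≡d e) })
  bis (w , n , _) (v , _ , _) (refl , refl , refl , suc j , n+j≡d , same , forth , back) =
    same ,
    (λ { (w′ , _) (Rww′ , refl , refl , e) →
         let (v′ , Rvv′ , z) = forth w′ Rww′
         in (v′ , suc n , true) , (Rvv′ , refl , refl , e) ,
            refl , refl , refl , j , trans (sym (+-suc n j)) n+j≡d , z }) ,
    (λ { (v′ , _) (Rvv′ , refl , refl , e) →
         let (w′ , Rww′ , z) = back v′ Rvv′
         in (w′ , suc n , true) , (Rww′ , refl , refl , e) ,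
            refl , refl , refl , j , trans (sym (+-suc n j)) n+j≡d , z })

-- `P` is carried from `A` to its truncation, over to the truncation of `B`, and back to `B`.
truncation⇒kInvariant : {P : TeamProperty X ℓ} (d : ℕ) → BisimInvariant P →
  (∀ A → Layered true d A ∈ P ⇔ Layered false d A ∈ P) → KBisimInvariant d P
truncation⇒kInvariant {P = P} d inv trunc A B A∈P A~B =
  from (P⇔ B) (to (bisimInvariant-⇔ inv _ _ (truncated-bisim d A B A~B)) (to (P⇔ A) A∈P))
  where
  P⇔ : ∀ A → A ∈ P ⇔ Layered false d A ∈ P
  P⇔ A = trunc A ⇔-∘ bisimInvariant-⇔ inv _ _ (unlayer-bisim d A)

-- Every edge raises the level by one, so the level of a node reached from the team is its distance
-- from the team.
path-level : (s : Bool) (d : ℕ) (A : TeamModel X) (k : ℕ) {x y : W (model (Layered s d A))} →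
             Path (model (Layered s d A)) k x y → proj₁ (proj₂ y) ≡ k + proj₁ (proj₂ x)
path-level s d A zero    refl = refl
path-level s d A (suc k) (_ , (_ , refl , _) , pth) =
  trans (path-level s d A k pth) (+-suc k _)

Nᵀ-level : (s : Bool) (d : ℕ) (A : TeamModel X) {y : W (model (Layered s d A))} →
           y ∈ Nᵀ (model (Layered s d A)) d (team (Layered s d A)) → proj₁ (proj₂ y) ≤ d
Nᵀ-level s d A (_ , (_ , refl , _) , k , (pth , _) , k≤d) =
  subst (_≤ d) (sym (trans (path-level s d A k pth) (+-identityʳ k))) k≤d

module Locality (em : ∀ {a} → ExcludedMiddle a) where

  -- `N` demands a shortest path; this finds its length from that of any path, testing upwards from
  -- 0.
  least : (P : Pred ℕ 0ℓ) (n : ℕ) → n ∈ P → ∃[ m ] ((m ∈ P × (∀ k → k ∈ P → m ≤ k)) × m ≤ n)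
  least P n n∈P with em {P = 0 ∈ P}
  least P n       n∈P | yes 0∈P = 0 , (0∈P , λ _ _ → z≤n) , z≤n
  least P zero    n∈P | no 0∉P = contradiction n∈P 0∉P
  least P (suc n) n∈P | no 0∉P =
    let (m , (m∈P , m-min) , m≤n) = least (P ∘ suc) n n∈P
    in suc m ,
       (m∈P , λ { zero 0∈P → contradiction 0∈P 0∉P ; (suc k) k∈P → s≤s (m-min k k∈P) }) ,
       s≤s m≤n

  reached⇒Nᵀ : (A : TeamModel X) {n d : ℕ} {u : W (model A)} →
               Reached A n u → n ≤ d → u ∈ Nᵀ (model A) d (team A)
  reached⇒Nᵀ A (t , t∈T , pth) n≤d =
    let (m , dist , m≤n) = least _ _ pth in t , t∈T , m , dist , ≤-trans m≤n n≤d

  -- Each step trades a remaining round for one more step away from the team, so `j + i` stays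
  -- constant and the successors met lie within distance `d`.
  restrict-Bisim : (d : ℕ) (A : TeamModel X) (i : ℕ) {j : ℕ} →
                   (u : W (model (neighbourhood d A))) → Reached A j (value u) → j + i ≤ d →
                   Bisim i (model A) (model (neighbourhood d A)) (value u) u
  restrict-Bisim d A zero    u r j+i≤d p = ⇔-id _
  restrict-Bisim d A (suc i) {j} u r j+i≤d =
    (λ p → ⇔-id _) ,
    (λ v Ruv → let v′ = v ,ʳ [ reached⇒Nᵀ A (reached-suc A r Ruv) (m+n≤o⇒m≤o _ 1+j+i≤d) ] in
      v′ , Ruv , restrict-Bisim d A i v′ (reached-suc A r Ruv) 1+j+i≤d) ,
    (λ v′ Ruv → value v′ , Ruv , restrict-Bisim d A i v′ (reached-suc A r Ruv) 1+j+i≤d)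
    where
    1+j+i≤d : suc j + i ≤ d
    1+j+i≤d = subst (_≤ d) (+-suc j i) j+i≤d

  neighbourhood-TeamBisim : (d : ℕ) (A : TeamModel X) → TeamBisim d A (neighbourhood d A)
  neighbourhood-TeamBisim d A =
    (λ w w∈T → let w′ = w ,ʳ [ T⊆Nᵀ (model A) d (team A) w∈T ] in
      w′ , w∈T , restrict-Bisim d A d w′ (w , w∈T , refl) ≤-refl) ,
    (λ w′ w∈T → value w′ , w∈T , restrict-Bisim d A d w′ (value w′ , w∈T , refl) ≤-refl)

  kInvariant⇒local : {P : TeamProperty X ℓ} (k : ℕ) → KBisimInvariant k P → Local k P
  kInvariant⇒local k inv A = mk⇔
    (λ A∈P → inv A (neighbourhood k A) A∈P (neighbourhood-TeamBisim k A))
    (λ N∈P → inv (neighbourhood k A) A N∈P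
      (TeamBisim-sym k A (neighbourhood k A) (neighbourhood-TeamBisim k A)))

  -- On nodes reached from the team, distance is level, so both ways of cutting off remove the same
  -- edges; the relation is the identity on these nodes.
  neighbourhood-bisim : (d : ℕ) (A : TeamModel X) →
    FullTeamBisim (neighbourhood d (Layered true d A)) (Layered false d A)
  neighbourhood-bisim d A = Z , bis ,
    (λ { w w∈T@(_ , refl , refl) → value w , w∈T , refl , refl , value w , w∈T , refl }) ,
    (λ { v v∈T@(_ , refl , refl) → (v ,ʳ [ T⊆Nᵀ L.model d L.team v∈T ]) , v∈T ,
         refl , refl , v , v∈T , refl })
    where
    module L = TeamModel (Layered true d A)

    Z : REL (W (model (neighbourhood d (Layered true d A)))) (W (model (Layered false d A))) 0ℓ
    Z u (w , n , b) =
      value u ≡ (w , n , b) × b ≡ true × Reached (Layered true d A) n (w , n , b)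

    bis : IsBisimulation (model (neighbourhood d (Layered true d A))) (model (Layered false d A)) Z
    bis u (w , n , _) (refl , refl , r) =
      (λ p → ⇔-id _) ,
      (λ { ((v , _) ,ʳ [ near ]) Rwv@(Rwv₀ , refl , refl , _) →
           (v , suc n , true) ,
           -- `near` is irrelevant, but the bound on the level is decidable and hence recoverable
           -- from it.
           (Rwv₀ , refl , refl , inj₂ (recompute (_ ≤? _) (Nᵀ-level true d A near))) ,
           refl , refl , reached-suc (Layered true d A) r Rwv }) ,
      (λ { (v , _) (Rwv , refl , refl , inj₂ n<d) →
           let r′ = reached-suc (Layered true d A) r (Rwv , refl , refl , inj₁ refl) in
           ((v , suc n , true) ,ʳ [ reached⇒Nᵀ (Layered true d A) r′ n<d ]) ,
           (Rwv , refl , refl , inj₁ refl) , refl , refl , r′ })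

  local⇒kInvariant : {P : TeamProperty X ℓ} (d : ℕ) → BisimInvariant P → Local d P →
                     KBisimInvariant d P
  local⇒kInvariant d inv local = truncation⇒kInvariant d inv λ A →
    bisimInvariant-⇔ inv _ _ (neighbourhood-bisim d A) ⇔-∘ local (Layered true d A)

-- Indistinguishability of the layered models by first-order sentences

-- How far from all pebbles the cut must be for Duplicator to win the game on φ;
-- it halves with each move.
radius : ∀ {n} → FO X n → ℕ
radius (x ≐ᶠ y) = 1
radius (Eᶠ x y) = 1
radius (Tᶠ x)   = 1
radius (Wᶠ p x) = 1
radius (¬ᶠ φ)   = radius φ
radius (φ ∧ᶠ ψ) = radius φ ⊔ radius ψ
radius (φ ∨ᶠ ψ) = radius φ ⊔ radius ψ
radius (∃ᶠ φ)   = radius φ + radius φ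
radius (∀ᶠ φ)   = radius φ + radius φ

-- This is |n - c| ≥ r, split by the side of the cut on which `n` lies.
Far : ℕ → ℕ → ℕ → Set
Far r c n = n + r ≤ c ⊎ c + r ≤ n

Far-antitone : ∀ {r r′ c n} → r′ ≤ r → Far r c n → Far r′ c n
Far-antitone {c = c} {n} r′≤r =
  Sum.map (≤-trans (+-monoʳ-≤ n r′≤r)) (≤-trans (+-monoʳ-≤ c r′≤r))

radius-positive : ∀ {n} (φ : FO X n) → 1 ≤ radius φ
radius-positive (x ≐ᶠ y) = ≤-refl
radius-positive (Eᶠ x y) = ≤-refl
radius-positive (Tᶠ x)   = ≤-refl
radius-positive (Wᶠ p x) = ≤-refl
radius-positive (¬ᶠ φ)   = radius-positive φ
radius-positive (φ ∧ᶠ ψ) = m≤n⇒m≤n⊔o (radius ψ) (radius-positive φ)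
radius-positive (φ ∨ᶠ ψ) = m≤n⇒m≤n⊔o (radius ψ) (radius-positive φ)
radius-positive (∃ᶠ φ)   = m≤n⇒m≤n+o (radius φ) (radius-positive φ)
radius-positive (∀ᶠ φ)   = m≤n⇒m≤n+o (radius φ) (radius-positive φ)

below : ∀ {c n} → n < c → does (c ≤? n) ≡ false
below {c} {n} n<c = dec-false (c ≤? n) (<⇒≱ n<c)

above : ∀ {c n} → c ≤ n → does (c ≤? n) ≡ true
above {c} {n} c≤n = dec-true (c ≤? n) c≤n

map-cong-lookup : {A B : Set} {n : ℕ} {f g : A → B} (xs : Vec A n) →
                  (∀ i → f (lookup xs i) ≡ g (lookup xs i)) → Vec.map f xs ≡ Vec.map g xs
map-cong-lookup []       eq = refl
map-cong-lookup (x ∷ xs) eq = cong₂ _∷_ (eq zero) (map-cong-lookup xs (eq ∘ suc))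

module Game (d : ℕ) (A : TeamModel X) where

  𝔐 𝔑 : Structure X
  𝔐 = structure (Layered true d A)
  𝔑 = structure (Layered false d A)

  Node : Set
  Node = W (model A) × ℕ × Bool

  level : Node → ℕ
  level (_ , n , _) = n

  -- A bijection from 𝔐 to 𝔑 that breaks only edges from level c - 1 to level c:
  -- below c (at most d) both sides have the same edges, and from c on swapping the
  -- sides exchanges the full and the truncated one.
  cut : ℕ → Node → Node
  cut c (w , n , b) = w , n , does (c ≤? n) xor b

  cut-involutive : ∀ c x → cut c (cut c x) ≡ x
  cut-involutive c (w , n , b) =
    cong (λ b′ → w , n , b′)
      (trans (sym (xor-assoc s s b)) (cong (_xor b) (xor-same s)))
    where s = does (c ≤? n)

  -- The interval of radius `r` around the cut fits between levels 0 and `d` and has no pebble in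
  -- its interior. For positive `r`, the team thus lies below the cut, and below the cut both sides
  -- have all edges.
  record Window {k : ℕ} (r c : ℕ) (ρ : Vec Node k) : Set where
    field
      r≤c   : r ≤ c
      c+r≤d : c + r ≤ d
      far   : ∀ i → Far r c (level (lookup ρ i))

  open Window

  Window-antitone : ∀ {k r r′ c} {ρ : Vec Node k} → r′ ≤ r → Window r c ρ → Window r′ c ρ
  Window-antitone {c = c} r′≤r win = record
    { r≤c   = ≤-trans r′≤r (r≤c win)
    ; c+r≤d = ≤-trans (+-monoʳ-≤ c r′≤r) (c+r≤d win)
    ; far   = Far-antitone r′≤r ∘ far win
    }

  -- `c′` depends only on the level of the new pebble, so it is available before the world and side
  -- are known. `agree` keeps the replies to earlier pebbles.
  record Move {k : ℕ} (r c : ℕ) (ρ : Vec Node k) (n : ℕ) : Set where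
    field
      c′     : ℕ
      window : ∀ w b → Window r c′ ((w , n , b) ∷ ρ)
      agree  : Vec.map (cut c) ρ ≡ Vec.map (cut c′) ρ

  module _ {k r c : ℕ} {ρ : Vec Node k} (1≤r : 1 ≤ r) (win : Window (r + r) c ρ) where

    private
      1≤r+r : 1 ≤ r + r
      1≤r+r = m≤n⇒m≤n+o r 1≤r

    shift : ∀ {n} c′ → r ≤ c′ → c′ + r ≤ d → Far r c′ n →
            (∀ {m} → m + (r + r) ≤ c → m + r ≤ c′) →
            (∀ {m} → c + (r + r) ≤ m → c′ + r ≤ m) → Move r c ρ n
    shift c′ r≤c′ c′+r≤d far-n low high = record
      { c′     = c′
      ; window = λ w b → record
        { r≤c   = r≤c′
        ; c+r≤d = c′+r≤d
        ; far   = λ { zero → far-n ; (suc i) → Sum.map low high (far win i) }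
        }
      ; agree  = map-cong-lookup ρ (λ i → same-side (lookup ρ i) (far win i))
      }
      where
      same-side : ∀ x → Far (r + r) c (level x) → cut c x ≡ cut c′ x
      same-side (w , n , b) (inj₁ n+2r≤c) =
        cong (λ s → w , n , s xor b)
          (trans (below (≤-trans (m<m+n n 1≤r+r) n+2r≤c))
                 (sym (below (≤-trans (m<m+n n 1≤r) (low n+2r≤c)))))
      same-side (w , n , b) (inj₂ c+2r≤n) =
        cong (λ s → w , n , s xor b)
          (trans (above (≤-trans (m≤m+n c (r + r)) c+2r≤n))
                 (sym (above (≤-trans (m≤m+n c′ r) (high c+2r≤n)))))

    -- The new pebble leaves one half of the window free; the cut moves to the
    -- middle of that half.
    move : ∀ n → Move r c ρ n
    move n with c ≤? n
    ... | no c≰n =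
      shift (c + r) (m≤n+m r c) (≤-trans (≤-reflexive (+-assoc c r r)) (c+r≤d win))
        (inj₁ (+-monoˡ-≤ r (<⇒≤ (≰⇒> c≰n))))
        (λ m+2r≤c → ≤-trans (+-monoʳ-≤ _ (m≤m+n r r)) (≤-trans m+2r≤c (m≤m+n c r)))
        (≤-trans (≤-reflexive (+-assoc c r r)))
    -- Matching on this equation writes `c` as `c′ + r`; the subtraction is exact because `r ≤ c`.
    ... | yes c≤n with c ∸ r | m∸n+n≡m (≤-trans (m≤m+n r r) (r≤c win))
    ... | c′ | refl =
      shift c′ (+-cancelʳ-≤ r r c′ (r≤c win)) (≤-trans (m≤m+n _ (r + r)) (c+r≤d win))
        (inj₂ c≤n)
        (λ {m} m+2r≤c → +-cancelʳ-≤ r (m + r) c′ (≤-trans (≤-reflexive (+-assoc m r r)) m+2r≤c))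
        (≤-trans (m≤m+n _ (r + r)))

  module _ {c : ℕ} (1≤c : 1 ≤ c) (c<d : c + 1 ≤ d) where

    atom-team : ∀ x → Far 1 c (level x) →
                team (Layered true d A) x ⇔ team (Layered false d A) (cut c x)
    atom-team (w , n , b) (inj₁ n<c) rewrite below (≤-trans (≤-reflexive (+-comm 1 n)) n<c) = ⇔-id _
    atom-team (w , n , b) (inj₂ c<n) = mk⇔ (impossible c<n) (impossible c<n)
      where
      impossible : ∀ {n b b′} {U V : Set} → c + 1 ≤ n → U × n ≡ 0 × b ≡ b′ → V
      impossible c<0 (_ , refl , _) = contradiction (≤-trans (m≤n+m 1 c) c<0) λ ()

    -- Edges join consecutive levels, so none between far nodes crosses the cut. Below it the side
    -- is immaterial, as levels are at most `d`; above it, swapping the sides of the nodes matches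
    -- the exchange of the full side.
    atom-edge : ∀ x y → Far 1 c (level x) → Far 1 c (level y) →
                R (model (Layered true d A)) x y ⇔
                R (model (Layered false d A)) (cut c x) (cut c y)
    atom-edge (w , n , b) (v , m , b′) (inj₁ n<c) (inj₁ m<c)
      rewrite below (≤-trans (≤-reflexive (+-comm 1 n)) n<c)
            | below (≤-trans (≤-reflexive (+-comm 1 m)) m<c) = mk⇔ swap-bound swap-bound
      where
      m≤d : m ≤ d
      m≤d = ≤-trans (m≤m+n m 1) (≤-trans m<c (≤-trans (m≤m+n c 1) c<d))
      swap-bound : ∀ {s s′} → R (model (Layered s d A)) (w , n , b) (v , m , b′) →
                              R (model (Layered s′ d A)) (w , n , b) (v , m , b′)
      swap-bound (Rwv , m≡ , b≡ , _) = Rwv , m≡ , b≡ , inj₂ m≤d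
    atom-edge (w , n , b) (v , m , b′) (inj₁ n<c) (inj₂ c<m) = mk⇔ impossible impossible
      where
      impossible : ∀ {U V V′ : Set} → U × m ≡ suc n × V → V′
      impossible (_ , refl , _) =
        contradiction (≤-trans (≤-trans (≤-reflexive (+-comm 1 _)) c<m)
                               (≤-trans (≤-reflexive (+-comm 1 n)) n<c)) (n≮n c)
    atom-edge (w , n , b) (v , m , b′) (inj₂ c<n) (inj₁ m<c) = mk⇔ impossible impossible
      where
      impossible : ∀ {U V V′ : Set} → U × m ≡ suc n × V → V′
      impossible (_ , refl , _) =
        contradiction (≤-trans (≤-trans (m≤m+n (suc n) 1) m<c) (≤-trans (m≤m+n c 1) c<n))
                      (n≮n n)
    atom-edge (w , n , b) (v , m , b′) (inj₂ c<n) (inj₂ c<m)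
      rewrite above (≤-trans (m≤m+n c 1) c<n) | above (≤-trans (m≤m+n c 1) c<m) = mk⇔
        (λ (Rwv , m≡ , b≡ , e) → Rwv , m≡ , cong not b≡ , Sum.map₁ (cong not) e)
        (λ (Rwv , m≡ , b≡ , e) → Rwv , m≡ , not-injective b≡ , Sum.map₁ not-injective e)

  indistinguishable : ∀ {k c} {ρ : Vec Node k} (φ : FO X k) → Window (radius φ) c ρ →
                      Sat 𝔐 φ ρ ⇔ Sat 𝔑 φ (Vec.map (cut c) ρ)
  respond : ∀ {k c} {ρ : Vec Node k} (φ : FO X (suc k)) → Window (radius φ + radius φ) c ρ →
            ∀ n → ∃[ c′ ] (∀ w b → Sat 𝔐 φ ((w , n , b) ∷ ρ) ⇔
                                   Sat 𝔑 φ (cut c′ (w , n , b) ∷ Vec.map (cut c) ρ))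
  respond⁻ : ∀ {k c} {ρ : Vec Node k} (φ : FO X (suc k)) → Window (radius φ + radius φ) c ρ →
             ∀ y → ∃[ x ] (Sat 𝔐 φ (x ∷ ρ) ⇔ Sat 𝔑 φ (y ∷ Vec.map (cut c) ρ))

  indistinguishable {c = c} {ρ} (x ≐ᶠ y) win
    rewrite lookup-map x (cut c) ρ | lookup-map y (cut c) ρ = mk⇔
      (cong (cut c))
      (λ eq → trans (sym (cut-involutive c _)) (trans (cong (cut c) eq) (cut-involutive c _)))
  indistinguishable {c = c} {ρ} (Eᶠ x y) win
    rewrite lookup-map x (cut c) ρ | lookup-map y (cut c) ρ =
      atom-edge (r≤c win) (c+r≤d win) (lookup ρ x) (lookup ρ y) (far win x) (far win y)
  indistinguishable {c = c} {ρ} (Tᶠ x) win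
    rewrite lookup-map x (cut c) ρ =
      atom-team (r≤c win) (c+r≤d win) (lookup ρ x) (far win x)
  indistinguishable {c = c} {ρ} (Wᶠ p x) win
    rewrite lookup-map x (cut c) ρ = ⇔-id _
  indistinguishable (¬ᶠ φ) win = ¬-cong-⇔ (indistinguishable φ win)
  indistinguishable (φ ∧ᶠ ψ) win =
    indistinguishable φ (Window-antitone (m≤m⊔n _ _) win) ×-⇔
    indistinguishable ψ (Window-antitone (m≤n⊔m (radius φ) _) win)
  indistinguishable (φ ∨ᶠ ψ) win =
    indistinguishable φ (Window-antitone (m≤m⊔n _ _) win) ⊎-⇔
    indistinguishable ψ (Window-antitone (m≤n⊔m (radius φ) _) win)
  indistinguishable (∃ᶠ φ) win = mk⇔
    (λ ((w , n , b) , sat) → let (_ , equiv) = respond φ win n in _ , to (equiv w b) sat)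
    (λ (y , sat) → let (x , equiv) = respond⁻ φ win y in x , from equiv sat)
  indistinguishable (∀ᶠ φ) win = mk⇔
    (λ sat y → let (x , equiv) = respond⁻ φ win y in to equiv (sat x))
    (λ { sat (w , n , b) → let (_ , equiv) = respond φ win n in from (equiv w b) (sat _) })

  respond {c = c} {ρ} φ win n =
    c′ , λ w b → subst (λ ρ′ → Sat 𝔐 φ ((w , n , b) ∷ ρ) ⇔ Sat 𝔑 φ (cut c′ (w , n , b) ∷ ρ′))
                       (sym agree) (indistinguishable φ (window w b))
    where open Move (move (radius-positive φ) win n)

  respond⁻ {c = c} {ρ} φ win y@(w , n , b) =
    -- `x` will have the same level as `y`, so `c′` can be found first; then `x` is the preimage of
    -- `y` because `cut c′` is an involution.
    let (c′ , equiv) = respond φ win n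
        x            = cut c′ y
    in x , subst (λ z → Sat 𝔐 φ (x ∷ ρ) ⇔ Sat 𝔑 φ (z ∷ Vec.map (cut c) ρ))
                 (cut-involutive c′ y) (equiv w _)

firstOrder⇒kInvariant : {P : TeamProperty X ℓ} (φ : Sentence X) → ExpressesFO φ P →
                        BisimInvariant P → KBisimInvariant (radius φ + radius φ) P
firstOrder⇒kInvariant φ expr inv = truncation⇒kInvariant _ inv λ A →
  ⇔-sym (expr _) ⇔-∘
  -- The cut starts halfway between levels 0 and `d`, leaving `radius φ` free on either side, with
  -- no pebble placed yet.
  (Game.indistinguishable _ A {c = radius φ} φ
    (record { r≤c = ≤-refl ; c+r≤d = ≤-refl ; far = λ () }) ⇔-∘
   expr _)

theorem3p4 : (∀ {a} → ExcludedMiddle a) →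
    ∀ {X : Set} {n : ℕ} → X ↔ Fin (suc n) →
    ∀ {ℓ} (P : TeamProperty X ℓ) →
    let i   = ∃ λ (φ : MTL X) → ExpressesMTL φ P
        ii  = (∃ λ (φ : Sentence X) → ExpressesFO φ P) × BisimInvariant P
        iii = ∃ λ (k : ℕ) → KBisimInvariant k P
        iv  = BisimInvariant P × (∃ λ (d : ℕ) → Local d P)
    in (i ⇔ ii) × (ii ⇔ iii) × (iii ⇔ iv)
theorem3p4 em {X} {n} X↔Fin P =
  -- The equivalence of (i) and (ii) goes through (iii).
  mk⇔ (iii⇒ii ∘ i⇒iii) (iii⇒i ∘ ii⇒iii) ,
  mk⇔ ii⇒iii iii⇒ii ,
  mk⇔ (λ (k , inv) → kInvariant⇒bisimInvariant k inv , k , kInvariant⇒local k inv)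
      (λ (inv , d , local) → d , local⇒kInvariant d inv local)
  where
  open Classical em
  open Locality em
  module X↔Fin = Inverse X↔Fin

  complete : ∀ q → q ∈ˡ map X↔Fin.from (allFin (suc n))
  complete q = subst (_∈ˡ _) (X↔Fin.strictlyInverseʳ q) (∈-map⁺ X↔Fin.from (∈-allFin (X↔Fin.to q)))

  define : ∀ {k} → KBisimInvariant k P → Definable P
  define {k} = kInvariant⇒definable (X↔Fin.from zero) _ complete k

  i⇒iii : ∃ (λ φ → ExpressesMTL φ P) → ∃ λ k → KBisimInvariant k P
  i⇒iii (φ , expr) = depth φ , expressesMTL⇒kInvariant φ expr

  iii⇒i : (∃ λ k → KBisimInvariant k P) → ∃ λ φ → ExpressesMTL φ P
  iii⇒i (_ , inv) = proj₁ (define inv)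

  iii⇒ii : (∃ λ k → KBisimInvariant k P) → (∃ λ φ → ExpressesFO φ P) × BisimInvariant P
  iii⇒ii (k , inv) = proj₂ (define inv) , kInvariant⇒bisimInvariant k inv

  ii⇒iii : (∃ λ φ → ExpressesFO φ P) × BisimInvariant P → ∃ λ k → KBisimInvariant k P
  ii⇒iii ((φ , expr) , inv) = _ , firstOrder⇒kInvariant φ expr inv
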